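{- Let $\mathcal{A}$ be a $\sigma$-structure. There is a bijective correspondence between (1) $\mathbb{G}^{\mathfrak{g}}$-coalgebras $\mathcal{A} \to \mathbb{G}^{\mathfrak{g}} \mathcal{A}$, and (2) $\mathfrak{g}$-guarded decompositions $\tau$ of $\mathcal{A}$.
   Context: $\mathfrak{g}$ is atom, loose or clique guarding. $\mathbb{G}^{\mathfrak{g}}$ is the guarded comonad: $\mathbb{G}^{\mathfrak{g}}\mathcal{A}$ has universe the equivalence classes $[p,a]$ of focussed plays $\langle p,a\rangle$, where $p=[U_1,\ldots,U_n]$ is a non-empty list of $\mathfrak{g}$-guarded sets of $\mathcal{A}$ and $a\in\lambda(p)=U_n$, under $\langle p,a\rangle\sim\langle q,a'\rangle$ iff $a=a'$, $p\sqcap q$ is non-empty, and $a\in\lambda(u)$ for all $u\in[p\sqcap q,p]\cup[p\sqcap q,q]$ (prefix order); $R^{\mathbb{G}\mathcal{A}}=\{([p,a_1],\ldots,[p,a_r])\mid R^{\mathcal{A}}(a_1,\ldots,a_r)\}$; counit $\varepsilon([p,a])=a$ and comultiplication $\delta([[U_1,\ldots,U_n],a]) = [[T_1,\ldots,T_n],[[U_1,\ldots,U_n],a]]$ with $T_j=\{[[U_1,\ldots,U_j],b]\mid b\in U_j\}$. A coalgebra is a homomorphism $\alpha:\mathcal{A}\to\mathbb{G}\mathcal{A}$ with $\varepsilon\circ\alpha=\mathsf{id}$ and $\delta\circ\alpha=\mathbb{G}\alpha\circ\alpha$. Let $\mathsf{Plays}^{\mathfrak{g}}(\mathcal{A})$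 be the set of such plays. A function $\tau:A\to\mathsf{Plays}^{\mathfrak{g}}(\mathcal{A})$ with image $P_\tau$ (a forest under prefix order) is a $\mathfrak{g}$-guarded decomposition if: (reflexive) $a\in\lambda(\tau(a))$ for all $a$; (edge covering) if $a,b$ are adjacent in the Gaifman graph of $\mathcal{A}$ then $\{a,b\}\subseteq\lambda(p)$ for some $p\in P_\tau$; (minimal) if $\tau(a)=p$ and $[p,a]=[q,a]$ for a play $q$, then $p\sqsubseteq q$; (vertex connected) for all $q$ in the downward closure of $P_\tau$, if $a\in\lambda(q)$ then $[\tau(a),a]=[q,a]$. -}

module Defs where

open import Axiom.ExcludedMiddle using (ExcludedMiddle)
open import Data.Empty using (⊥-elim)
open import Data.Fin.Base using (Fin)
open import Data.List.Base as List using (List; []; _∷_; length; take)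
import Data.List.Properties as List
open import Data.List.NonEmpty as List⁺
  using (List⁺; _∷_; [_]; toList; _∷⁺_; _⁺∷ʳ_; last)
open import Data.List.Relation.Binary.Pointwise as Pointwise
  using (Pointwise; []; _∷_)
open import Data.List.Relation.Binary.Prefix.Heterogeneous
  using (Prefix; []; _∷_) renaming (map to Prefix-map)
import Data.List.Relation.Binary.Prefix.Heterogeneous.Properties as Prefix
open import Data.Nat.Base using (ℕ; zero; suc; NonZero; z≤n; s≤s)
import Data.Nat.Base as ℕ
open import Data.Product.Base using (Σ; ∃; _×_; _,_; proj₁; proj₂; swap)
open import Data.Sum.Base using (_⊎_; inj₁; inj₂)
open import Data.Unit.Base using (⊤)
open import Data.Vec.Functional using (Vector; map)
open import Function.Base using (_∘_; _on_)
open import Function.Bundles using (Func)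
open import Level using (Level; _⊔_) renaming (suc to lsuc)
open import Relation.Binary.Bundles using (Setoid)
open import Relation.Binary.Core using (Rel)
open import Relation.Binary.Definitions using (Decidable; _Respects_)
open import Relation.Binary.PropositionalEquality as ≡ using (_≡_; _≢_; refl)
open import Relation.Nullary.Decidable.Core using (yes; no)
open import Relation.Nullary.Negation.Core using (¬_)
open import Relation.Unary using (Pred; Satisfiable; _≐_)

private
  variable
    a b c s ℓ ℓ′ : Level

module _ {A : Set a} where

  last-∷ : ∀ (x y : A) zs → last (x ∷ (y ∷ zs)) ≡ last (y ∷ zs)
  last-∷ x y zs with List.initLast zs
  ... | []            = refl
  ... | ws List.∷ʳ′ w = refl

  last-⁺∷ʳ : ∀ (p : List⁺ A) y → last (p ⁺∷ʳ y) ≡ y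
  last-⁺∷ʳ (x ∷ xs) y = go x xs
    where
    go : ∀ x xs → last ((x ∷ xs) ⁺∷ʳ y) ≡ y
    go x []       = refl
    go x (z ∷ zs) = ≡.trans (last-∷ x z (zs List.++ (y ∷ []))) (go z zs)

  -- The non-empty prefixes of a list, in increasing order.
  prefixesˡ : List A → List (List⁺ A)
  prefixesˡ []       = []
  prefixesˡ (x ∷ xs) = [ x ] ∷ List.map (x ∷⁺_) (prefixesˡ xs)

  prefixes : List⁺ A → List⁺ (List⁺ A)
  prefixes (x ∷ xs) = [ x ] ∷ List.map (x ∷⁺_) (prefixesˡ xs)

  take⁺ : ℕ → List⁺ A → List⁺ A
  take⁺ n (x ∷ xs) = x ∷ take n xs

  size : List⁺ A → ℕ
  size (x ∷ xs) = length xs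

module _ {A : Set a} {B : Set b} (f : A → B) where

  last-map : ∀ p → last (List⁺.map f p) ≡ f (last p)
  last-map (x ∷ xs) = go x xs
    where
    go : ∀ x xs → last (List⁺.map f (x ∷ xs)) ≡ f (last (x ∷ xs))
    go x []       = refl
    go x (y ∷ ys) = ≡.trans (last-∷ (f x) (f y) (List.map f ys))
      (≡.trans (go y ys) (≡.cong f (≡.sym (last-∷ x y ys))))

  take⁺-map : ∀ n p → List⁺.map f (take⁺ n p) ≡ take⁺ n (List⁺.map f p)
  take⁺-map n (x ∷ xs) = ≡.cong (f x ∷_) (≡.sym (List.take-map n xs))

  size-map : ∀ p → size (List⁺.map f p) ≡ size p
  size-map (x ∷ xs) = List.length-map f xs

module _ {A : Set a} where

  last-prefixes : ∀ (p : List⁺ A) → last (prefixes p) ≡ p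
  last-prefixes (x ∷ xs) = go x xs
    where
    go : ∀ x xs → last (prefixes (x ∷ xs)) ≡ x ∷ xs
    go x []       = refl
    go x (y ∷ ys) =
      ≡.trans (last-∷ [ x ] (x ∷⁺ [ y ]) (List.map (x ∷⁺_) (List.map (y ∷⁺_) (prefixesˡ ys))))
        (≡.trans (last-map (x ∷⁺_) (prefixes (y ∷ ys)))
          (≡.cong (x ∷⁺_) (go y ys)))

  prefixesˡ-take : ∀ n (xs : List A) → prefixesˡ (take n xs) ≡ take n (prefixesˡ xs)
  prefixesˡ-take zero    xs       = refl
  prefixesˡ-take (suc n) []       = refl
  prefixesˡ-take (suc n) (x ∷ xs) = ≡.cong ([ x ] ∷_)
    (≡.trans (≡.cong (List.map (x ∷⁺_)) (prefixesˡ-take n xs))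
             (≡.sym (List.take-map n (prefixesˡ xs))))

  prefixes-take⁺ : ∀ n (p : List⁺ A) → prefixes (take⁺ n p) ≡ take⁺ n (prefixes p)
  prefixes-take⁺ n (x ∷ xs) = ≡.cong ([ x ] ∷_)
    (≡.trans (≡.cong (List.map (x ∷⁺_)) (prefixesˡ-take n xs))
             (≡.sym (List.take-map n (prefixesˡ xs))))

  length-prefixesˡ : ∀ (xs : List A) → length (prefixesˡ xs) ≡ length xs
  length-prefixesˡ []       = refl
  length-prefixesˡ (x ∷ xs) =
    ≡.cong suc (≡.trans (List.length-map _ (prefixesˡ xs)) (length-prefixesˡ xs))

  size-prefixes : ∀ (p : List⁺ A) → size (prefixes p) ≡ size p
  size-prefixes (x ∷ xs) =
    ≡.trans (List.length-map _ (prefixesˡ xs)) (length-prefixesˡ xs)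

module PrefixOrder (S : Setoid c ℓ) where

  open Setoid S

  infix 4 _⊑ˡ_ _⊑_ _≋_

  _⊑ˡ_ : Rel (List Carrier) (c ⊔ ℓ)
  _⊑ˡ_ = Prefix _≈_

  _⊑_ : Rel (List⁺ Carrier) (c ⊔ ℓ)
  p ⊑ q = toList p ⊑ˡ toList q

  _≋_ : Rel (List⁺ Carrier) (c ⊔ ℓ)
  p ≋ q = Pointwise _≈_ (toList p) (toList q)

  List⁺-setoid : Setoid c (c ⊔ ℓ)
  List⁺-setoid = record
    { Carrier = List⁺ Carrier ; _≈_ = _≋_
    ; isEquivalence = record
      { refl  = Pointwise.refl (Setoid.refl S)
      ; sym   = Pointwise.symmetric (Setoid.sym S)
      ; trans = Pointwise.transitive (Setoid.trans S) } }

  ⊑-refl : ∀ {xs} → xs ⊑ˡ xs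
  ⊑-refl = Prefix.fromPointwise (Pointwise.refl (Setoid.refl S))

  ⊑-trans : ∀ {xs ys zs} → xs ⊑ˡ ys → ys ⊑ˡ zs → xs ⊑ˡ zs
  ⊑-trans = Prefix.trans (Setoid.trans S)

  ⊑-total : ∀ {xs ys zs} → xs ⊑ˡ zs → ys ⊑ˡ zs → xs ⊑ˡ ys ⊎ ys ⊑ˡ xs
  ⊑-total []       _        = inj₁ []
  ⊑-total (_ ∷ _)  []       = inj₂ []
  ⊑-total (e ∷ es) (f ∷ fs) with ⊑-total es fs
  ... | inj₁ xs⊑ys = inj₁ (Setoid.trans S e (Setoid.sym S f) ∷ xs⊑ys)
  ... | inj₂ ys⊑xs = inj₂ (Setoid.trans S f (Setoid.sym S e) ∷ ys⊑xs)

  ⊑-⁺∷ʳ : ∀ p y → p ⊑ (p ⁺∷ʳ y)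
  ⊑-⁺∷ʳ (x ∷ xs) y = Setoid.refl S ∷ go xs
    where
    go : ∀ zs → zs ⊑ˡ zs List.++ (y ∷ [])
    go []       = []
    go (z ∷ zs) = Setoid.refl S ∷ go zs

  ⊑-⁺∷ʳ⁻ : ∀ {u} p y → p ⊑ u → u ⊑ (p ⁺∷ʳ y) → p ≋ u ⊎ (p ⁺∷ʳ y) ≋ u
  ⊑-⁺∷ʳ⁻ (x ∷ xs) y (e ∷ es) (_ ∷ fs) with go es fs
    where
    go : ∀ {zs ws} → zs ⊑ˡ ws → ws ⊑ˡ zs List.++ (y ∷ []) →
         Pointwise _≈_ zs ws ⊎ Pointwise _≈_ (zs List.++ (y ∷ [])) ws
    go {[]}     []       []        = inj₁ []
    go {[]}     []       (e ∷ [])  = inj₂ (Setoid.sym S e ∷ [])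
    go {z ∷ zs} (e ∷ es) (f ∷ fs) with go es fs
    ... | inj₁ eq = inj₁ (e ∷ eq)
    ... | inj₂ eq = inj₂ (e ∷ eq)
  ... | inj₁ eq = inj₁ (e ∷ eq)
  ... | inj₂ eq = inj₂ (e ∷ eq)

  last-cong : ∀ {p q} → p ≋ q → last p ≈ last q
  last-cong {x ∷ xs} {y ∷ ys} (e ∷ es) = go e es
    where
    go : ∀ {x xs y ys} → x ≈ y → Pointwise _≈_ xs ys → last (x ∷ xs) ≈ last (y ∷ ys)
    go             e []       = e
    go {x} {y = y} _ (_∷_ {x′} {y′} {xs} {ys} e es) =
      ≡.subst₂ _≈_ (≡.sym (last-∷ x x′ xs)) (≡.sym (last-∷ y y′ ys)) (go e es)

  take-⊑ : ∀ n xs → take n xs ⊑ˡ xs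
  take-⊑ zero    xs       = []
  take-⊑ (suc n) []       = []
  take-⊑ (suc n) (x ∷ xs) = Setoid.refl S ∷ take-⊑ n xs

  ⊑-take : ∀ {n xs ys} → length xs ℕ.≤ n → xs ⊑ˡ ys → xs ⊑ˡ take n ys
  ⊑-take             _       []       = []
  ⊑-take {n = suc n} (s≤s l) (e ∷ es) = e ∷ ⊑-take l es

  ⊑⇒≋take : ∀ {xs ys} → xs ⊑ˡ ys → Pointwise _≈_ xs (take (length xs) ys)
  ⊑⇒≋take []       = []
  ⊑⇒≋take (e ∷ es) = e ∷ ⊑⇒≋take es

  -- The greatest lower bound for _⊑ˡ_, i.e. the longest common prefix;
  -- two plays may share no non-empty prefix, so it is a possibly empty list.
  module Meet (_≟_ : Decidable _≈_) where

    infixr 7 _⊓_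

    _⊓_ : List Carrier → List Carrier → List Carrier
    []       ⊓ ys       = []
    (x ∷ xs) ⊓ []       = []
    (x ∷ xs) ⊓ (y ∷ ys) with x ≟ y
    ... | yes _ = x ∷ (xs ⊓ ys)
    ... | no  _ = []

    ⊓-lowerˡ : ∀ xs ys → xs ⊓ ys ⊑ˡ xs
    ⊓-lowerˡ []       ys       = []
    ⊓-lowerˡ (x ∷ xs) []       = []
    ⊓-lowerˡ (x ∷ xs) (y ∷ ys) with x ≟ y
    ... | yes _ = Setoid.refl S ∷ ⊓-lowerˡ xs ys
    ... | no  _ = []

    ⊓-lowerʳ : ∀ xs ys → xs ⊓ ys ⊑ˡ ys
    ⊓-lowerʳ []       ys       = []
    ⊓-lowerʳ (x ∷ xs) []       = []
    ⊓-lowerʳ (x ∷ xs) (y ∷ ys) with x ≟ y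
    ... | yes e = e ∷ ⊓-lowerʳ xs ys
    ... | no  _ = []

    ⊓-greatest : ∀ {zs xs ys} → zs ⊑ˡ xs → zs ⊑ˡ ys → zs ⊑ˡ xs ⊓ ys
    ⊓-greatest []       _        = []
    ⊓-greatest {xs = x ∷ _} {ys = y ∷ _} (e ∷ es) (f ∷ fs) with x ≟ y
    ... | yes _   = e ∷ ⊓-greatest es fs
    ... | no  x≉y = ⊥-elim (x≉y (Setoid.trans S (Setoid.sym S e) f))

-- An operation on plays that preserves length and commutes with truncation
-- lifts intervals of the prefix order.
module _ (S : Setoid a ℓ) (T : Setoid b ℓ′)
         (F : List⁺ (Setoid.Carrier S) → List⁺ (Setoid.Carrier T))
         (F-take : ∀ n p → F (take⁺ n p) ≡ take⁺ n (F p))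
         (F-size : ∀ p → size (F p) ≡ size p)
         where
  private
    module S = PrefixOrder S
    module T = PrefixOrder T

  lift-interval : ∀ r p u → r S.⊑ p → F r T.⊑ u → u T.⊑ F p →
                  ∃ λ u′ → r S.⊑ u′ × u′ S.⊑ p × F u′ T.≋ u
  lift-interval r@(_ ∷ _) p@(x ∷ xs) u@(_ ∷ us) (e ∷ r⊑p) Fr⊑u u⊑Fp =
      take⁺ (size u) p
    , e ∷ S.⊑-take (≡.subst (ℕ._≤ size u) (F-size r) (size-mono Fr⊑u)) r⊑p
    , Setoid.refl S ∷ S.take-⊑ (size u) xs
    , ≡.subst (T._≋ u) (≡.sym (F-take (size u) p))
        (Setoid.sym T.List⁺-setoid {x = u} {y = take⁺ (size u) (F p)} (≋take⁺ u⊑Fp))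
    where
    size-mono : ∀ {p q} → p T.⊑ q → size p ℕ.≤ size q
    size-mono (_ ∷ es) = Prefix.length-mono es
    ≋take⁺ : ∀ {p q} → p T.⊑ q → p T.≋ take⁺ (size p) q
    ≋take⁺ (e ∷ es) = e ∷ T.⊑⇒≋take es

record Signature s : Set (lsuc s) where
  field
    Symbol  : Set s
    arity   : Symbol → ℕ
    arity>0 : ∀ R → NonZero (arity R)

open Signature

-- Sets are represented by setoids, as 𝔾𝒜 has a quotient as its universe.
-- The universe levels are kept uniform, so that 𝔾 raises the level of a
-- structure.
record Structure (σ : Signature s) ℓ : Set (s ⊔ lsuc ℓ) where
  field
    domain : Setoid ℓ ℓ
  open Setoid domain public
  field
    ⟦_⟧    : ∀ R → Vector Carrier (arity σ R) → Set ℓ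
    ⟦⟧-resp : ∀ R {xs ys} → (∀ i → xs i ≈ ys i) → ⟦ R ⟧ xs → ⟦ R ⟧ ys

open Structure using (domain)

∣_∣ : {σ : Signature s} → Structure σ ℓ → Set ℓ
∣ A ∣ = Structure.Carrier A

record Hom {σ : Signature s} (A : Structure σ ℓ) (B : Structure σ ℓ′)
       : Set (s ⊔ ℓ ⊔ ℓ′) where
  private
    module A = Structure A
    module B = Structure B
  field
    func      : Func (domain A) (domain B)
  open Func func public renaming (to to ⟨_⟩)
  field
    preserves : ∀ R {xs} → A.⟦ R ⟧ xs → B.⟦ R ⟧ (map ⟨_⟩ xs)

module _ {σ : Signature s} where

  _↾_ : (A : Structure σ ℓ) → Pred ∣ A ∣ ℓ → Structure σ ℓ
  A ↾ U = record
    { domain = record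
      { Carrier = Σ ∣ A ∣ U
      ; _≈_ = A._≈_ on proj₁
      ; isEquivalence = record { refl = A.refl ; sym = A.sym ; trans = A.trans } }
    ; ⟦_⟧     = λ R xs → A.⟦ R ⟧ (map proj₁ xs)
    ; ⟦⟧-resp = λ R → A.⟦⟧-resp R }
    where module A = Structure A

  module _ (A : Structure σ ℓ) where
    open Structure A

    support : ∀ {n} → Vector Carrier n → Pred Carrier ℓ
    support xs x = ∃ λ i → x ≈ xs i

    CoOccur : Rel Carrier (s ⊔ ℓ)
    CoOccur x y = ∃ λ R → ∃ λ xs → ⟦ R ⟧ xs × support xs x × support xs y

    -- Adjacency in the Gaifman graph
    Adjacent : Rel Carrier (s ⊔ ℓ)
    Adjacent x y = ¬ x ≈ y × CoOccur x y

    IsClique : Pred Carrier ℓ′ → Set (s ⊔ ℓ ⊔ ℓ′)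
    IsClique U = ∀ {x y} → U x → U y → ¬ x ≈ y → Adjacent x y

data Guard : Set where
  atom loose clique : Guard

module _ {σ : Signature s} where

  -- The sets of values of the variables of a guard that holds in A:
  -- for an atom guard (equality atoms x = x included), the elements of one
  -- tuple or a single element; for a loose guard, a non-empty set any two
  -- distinct elements of which occur in a tuple lying within the set; for a
  -- clique guard, where other variables may be existentially quantified, the
  -- tuple may lie anywhere in A.
  IsGuarded : Guard → (A : Structure σ ℓ) → Pred ∣ A ∣ ℓ → Set (s ⊔ ℓ)
  IsGuarded atom   A U = (∃ λ x → U ≐ λ y → y ≈ x)
                       ⊎ (∃ λ R → ∃ λ xs → ⟦ R ⟧ xs × U ≐ support A xs)
    where open Structure A
  IsGuarded loose  A U = Satisfiable U × IsClique (A ↾ U) (λ _ → ⊤)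
  IsGuarded clique A U = Satisfiable U × IsClique A U

  record GuardedSet (g : Guard) (A : Structure σ ℓ) : Set (s ⊔ lsuc ℓ) where
    field
      member  : Pred ∣ A ∣ ℓ
      resp    : member Respects Structure._≈_ A
      guarded : IsGuarded g A member

open GuardedSet

module _ {σ : Signature s} {A : Structure σ ℓ} {B : Structure σ (ℓ ⊔ ℓ′)}
         {U : Pred ∣ A ∣ ℓ} (h : Hom (A ↾ U) B)
         where
  private
    module A = Structure A
    module B = Structure B
    open Hom h using (⟨_⟩; cong; preserves)

  image : Pred ∣ B ∣ (ℓ ⊔ ℓ′)
  image y = ∃ λ x → y B.≈ ⟨ x ⟩

  image-resp : image Respects B._≈_
  image-resp y≈z (x , y≈hx) = x , B.trans (B.sym y≈z) y≈hx

  image-guarded : (∀ x y → Adjacent A (proj₁ x) (proj₁ y) → CoOccur B ⟨ x ⟩ ⟨ y ⟩) →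
                  ∀ g → IsGuarded g A U → IsGuarded g B image
  image-guarded _ atom (inj₁ (x , U⊆ , ⊆U)) = inj₁
    ( ⟨ x , ⊆U A.refl ⟩
    , (λ { ((y , Uy) , z≈) → B.trans z≈ (cong (U⊆ Uy)) })
    , (λ z≈ → _ , z≈) )
  image-guarded _ atom (inj₂ (R , xs , Rxs , U⊆ , ⊆U)) = inj₂
    ( R , map ⟨_⟩ xs′ , preserves R Rxs
    , (λ { ((y , Uy) , z≈) → let i , y≈ = U⊆ Uy in i , B.trans z≈ (cong y≈) })
    , (λ { (i , z≈) → xs′ i , z≈ }) )
    where
    xs′ : Vector (Σ ∣ A ∣ U) _
    xs′ i = xs i , ⊆U (i , A.refl)
  image-guarded _ loose ((x , Ux) , cl) =
      (_ , (x , Ux) , B.refl)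
    , λ { {_ , x , x≈} {_ , y , y≈} _ _ x≉y →
          let _ , R , xs , Rxs , (i , x≈i) , (j , y≈j) =
                cl {x} {y} _ _ λ x≈y →
                  x≉y (B.trans x≈ (B.trans (cong x≈y) (B.sym y≈)))
          in x≉y , R , (λ k → ⟨ xs k ⟩ , xs k , B.refl) , preserves R Rxs
             , (i , B.trans x≈ (cong x≈i)) , (j , B.trans y≈ (cong y≈j)) }
  image-guarded adj clique ((x , Ux) , cl) =
      (_ , (x , Ux) , B.refl)
    , λ { (x , x≈) (y , y≈) x≉y →
          let R , xs , Rxs , (i , x≈i) , (j , y≈j) =
                adj x y (cl (proj₂ x) (proj₂ y) λ x≈y →
                  x≉y (B.trans x≈ (B.trans (cong x≈y) (B.sym y≈))))
          in x≉y , R , xs , Rxs , (i , B.trans x≈ x≈i) , (j , B.trans y≈ y≈j) }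

module _ {σ : Signature s} (g : Guard) (A : Structure σ ℓ) where

  guardedSetoid : Setoid (s ⊔ lsuc ℓ) ℓ
  guardedSetoid = record
    { Carrier = GuardedSet g A
    ; _≈_ = _≐_ on member
    ; isEquivalence = record
      { refl  = (λ x → x) , (λ x → x)
      ; sym   = swap
      ; trans = λ p q → (proj₁ q ∘ proj₁ p) , (proj₂ p ∘ proj₂ q) } }

  Play : Set (s ⊔ lsuc ℓ)
  Play = List⁺ (GuardedSet g A)

  playSetoid : Setoid (s ⊔ lsuc ℓ) (s ⊔ lsuc ℓ)
  playSetoid = PrefixOrder.List⁺-setoid guardedSetoid

  infix 4 _∈λ_

  _∈λ_ : ∣ A ∣ → Play → Set ℓ
  x ∈λ p = member (last p) x

  record FocussedPlay : Set (s ⊔ lsuc ℓ) where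
    constructor ⟨_,_⟩[_]
    field
      play   : Play
      focus  : ∣ A ∣
      focus∈ : focus ∈λ play

open FocussedPlay

∈λ-resp : {σ : Signature s} {g : Guard} {A : Structure σ ℓ} (p q : Play g A) →
          PrefixOrder._≋_ (guardedSetoid g A) p q → ∀ {x} → _∈λ_ g A x p → _∈λ_ g A x q
∈λ-resp {g = g} {A = A} p q p≋q =
  proj₁ (PrefixOrder.last-cong (guardedSetoid g A) {p} {q} p≋q)

-- Excluded middle is used to compute p ⊓ q, which compares sets for equality.
module _ (em : ∀ {ℓ} → ExcludedMiddle ℓ) {σ : Signature s} (g : Guard) where

  module _ (A : Structure σ ℓ) where
    private
      module A = Structure A
      _∈ᴸ_ = _∈λ_ g A
    open PrefixOrder (guardedSetoid g A) public using (_⊑_; _⊑ˡ_; _≋_)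
    open PrefixOrder (guardedSetoid g A) using (⊑-refl; ⊑-trans; ⊑-total)
    open PrefixOrder.Meet (guardedSetoid g A) (λ _ _ → em) public

    -- The classes of P and Q coincide; a class [p , x] is represented by any
    -- of its members.
    record _∼_ (P Q : FocussedPlay g A) : Set (s ⊔ lsuc ℓ) where
      p⊓q = toList (play P) ⊓ toList (play Q)
      field
        focus≈   : focus P A.≈ focus Q
        nonEmpty : p⊓q ≢ []
        onˡ      : ∀ u → p⊓q ⊑ˡ toList u → u ⊑ play P → focus P ∈ᴸ u
        onʳ      : ∀ u → p⊓q ⊑ˡ toList u → u ⊑ play Q → focus P ∈ᴸ u

    open _∼_

    -- Any common non-empty prefix r will do, as the intervals above p ⊓ q are
    -- contained in those above r.
    common⇒∼ : ∀ {P Q} (r : Play g A) → focus P A.≈ focus Q → r ⊑ play P → r ⊑ play Q →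
               (∀ u → r ⊑ u → u ⊑ play P → focus P ∈ᴸ u) →
               (∀ u → r ⊑ u → u ⊑ play Q → focus P ∈ᴸ u) → P ∼ Q
    common⇒∼ {P} {Q} r eq r⊑p r⊑q onˡ onʳ = record
      { focus≈   = eq
      ; nonEmpty = ≢[] r⊑m
      ; onˡ      = λ u m⊑u → onˡ u (⊑-trans r⊑m m⊑u)
      ; onʳ      = λ u m⊑u → onʳ u (⊑-trans r⊑m m⊑u) }
      where
      r⊑m = ⊓-greatest r⊑p r⊑q
      ≢[] : ∀ {m} → toList r ⊑ˡ m → m ≢ []
      ≢[] () refl

    record Common (P Q : FocussedPlay g A) : Set (s ⊔ lsuc ℓ) where
      field
        root  : Play g A
        root⊑ˡ : root ⊑ play P
        root⊑ʳ : root ⊑ play Q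
        stayˡ : ∀ u → root ⊑ u → u ⊑ play P → focus P ∈ᴸ u
        stayʳ : ∀ u → root ⊑ u → u ⊑ play Q → focus P ∈ᴸ u

    ∼⇒common : ∀ {P Q} → P ∼ Q → Common P Q
    ∼⇒common {P} {Q} e = go _ refl
      where
      go : ∀ m → p⊓q e ≡ m → Common P Q
      go []       eq = ⊥-elim (nonEmpty e eq)
      go (x ∷ xs) eq = record
        { root   = x ∷ xs
        ; root⊑ˡ = ≡.subst (_⊑ˡ toList (play P)) eq (⊓-lowerˡ (toList (play P)) _)
        ; root⊑ʳ = ≡.subst (_⊑ˡ toList (play Q)) eq (⊓-lowerʳ (toList (play P)) _)
        ; stayˡ  = λ u r⊑u → onˡ e u (≡.subst (_⊑ˡ toList u) (≡.sym eq) r⊑u)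
        ; stayʳ  = λ u r⊑u → onʳ e u (≡.subst (_⊑ˡ toList u) (≡.sym eq) r⊑u) }

    -- Plays with the same focus are equivalent if one extends the other
    -- by sets containing the focus.
    ⊑⇒∼ : ∀ {P Q} → focus P A.≈ focus Q → play P ⊑ play Q →
          (∀ u → play P ⊑ u → u ⊑ play Q → focus P ∈ᴸ u) → P ∼ Q
    ⊑⇒∼ {P} {Q} eq p⊑q on =
      common⇒∼ {P} {Q} (play P) eq ⊑-refl p⊑q (λ u p⊑u u⊑p → on u p⊑u (⊑-trans u⊑p p⊑q)) on

    ≋⇒∼ : ∀ {P Q} → focus P A.≈ focus Q → play P ≋ play Q → P ∼ Q
    ≋⇒∼ {P} {Q} eq p≋q = ⊑⇒∼ eq (Prefix.fromPointwise p≋q) λ u p⊑u u⊑q →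
      ∈λ-resp (play P) u
        (Prefix.antisym (λ e _ → e) p⊑u (⊑-trans u⊑q (Prefix.fromPointwise
          (Setoid.sym (playSetoid g A) {play P} {play Q} p≋q))))
        (focus∈ P)

    ∼-sym : ∀ {P Q} → P ∼ Q → Q ∼ P
    ∼-sym {P} {Q} e = common⇒∼ {Q} {P} root (A.sym (focus≈ e)) root⊑ʳ root⊑ˡ
      (λ u r⊑u u⊑q → resp (last u) (focus≈ e) (stayʳ u r⊑u u⊑q))
      (λ u r⊑u u⊑p → resp (last u) (focus≈ e) (stayˡ u r⊑u u⊑p))
      where open Common (∼⇒common e)

    ∼-trans : ∀ {P Q R} → P ∼ Q → Q ∼ R → P ∼ R
    ∼-trans {P} {Q} {R} e f = go (⊑-total E.root⊑ʳ F.root⊑ˡ)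
      where
      module E = Common (∼⇒common e)
      module F = Common (∼⇒common f)
      back : ∀ {u} → focus Q ∈ᴸ u → focus P ∈ᴸ u
      back {u} = resp (last u) (A.sym (focus≈ e))
      split : ∀ {r′ t v w} → t ⊑ r′ → r′ ⊑ v → r′ ⊑ w →
              (∀ u → t ⊑ u → u ⊑ v → focus P ∈ᴸ u) →
              (∀ u → r′ ⊑ u → u ⊑ w → focus P ∈ᴸ u) →
              ∀ u → t ⊑ u → u ⊑ w → focus P ∈ᴸ u
      split t⊑r′ r′⊑v r′⊑w on₁ on₂ u t⊑u u⊑w with ⊑-total u⊑w r′⊑w
      ... | inj₁ u⊑r′ = on₁ u t⊑u (⊑-trans u⊑r′ r′⊑v)
      ... | inj₂ r′⊑u = on₂ u r′⊑u u⊑w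
      eq = A.trans (focus≈ e) (focus≈ f)
      go : E.root ⊑ F.root ⊎ F.root ⊑ E.root → P ∼ R
      go (inj₁ r⊑r′) = common⇒∼ {P} {R} E.root eq E.root⊑ˡ (⊑-trans r⊑r′ F.root⊑ʳ) E.stayˡ
        λ u r⊑u → split {F.root} {E.root} {play Q} {play R}
          r⊑r′ F.root⊑ˡ F.root⊑ʳ E.stayʳ
          (λ v r⊑v v⊑ → back {v} (F.stayʳ v r⊑v v⊑)) u r⊑u
      go (inj₂ r′⊑r) = common⇒∼ {P} {R} F.root eq (⊑-trans r′⊑r E.root⊑ˡ) F.root⊑ʳ
        (λ u r⊑u → split {E.root} {F.root} {play Q} {play P}
          r′⊑r E.root⊑ʳ E.root⊑ˡ (λ v r⊑v v⊑ → back {v} (F.stayˡ v r⊑v v⊑))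
          E.stayˡ u r⊑u)
        (λ v r⊑v v⊑ → back {v} (F.stayʳ v r⊑v v⊑))

    𝔾 : Structure σ (s ⊔ lsuc ℓ)
    𝔾 = record
      { domain = record
        { Carrier = FocussedPlay g A
        ; _≈_ = _∼_
        ; isEquivalence = record
          { refl  = λ {P} → ≋⇒∼ {P} {P} A.refl (Setoid.refl (playSetoid g A) {play P})
          ; sym   = ∼-sym
          ; trans = ∼-trans } }
      ; ⟦_⟧ = λ R Xs → ∃ λ p → ∃ λ xs → ∃ λ (xs∈ : ∀ i → xs i ∈ᴸ p) →
                A.⟦ R ⟧ xs × (∀ i → Xs i ∼ ⟨ p , xs i ⟩[ xs∈ i ])
      ; ⟦⟧-resp = λ { R Xs∼Ys (p , xs , xs∈ , Rxs , Xs∼) →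
                p , xs , xs∈ , Rxs , λ i → ∼-trans (∼-sym (Xs∼Ys i)) (Xs∼ i) } }

    ε : Hom 𝔾 A
    ε = record
      { func      = record { to = focus ; cong = focus≈ }
      ; preserves = λ { R (p , xs , xs∈ , Rxs , Xs∼) →
                      A.⟦⟧-resp R (λ i → A.sym (focus≈ (Xs∼ i))) Rxs } }

    support-guarded : ∀ R {xs} → A.⟦ R ⟧ xs → GuardedSet g A
    support-guarded R {xs} Rxs = record
      { member  = support A xs
      ; resp    = λ { x≈y (i , x≈) → i , A.trans (A.sym x≈y) x≈ }
      ; guarded = go g }
      where
      i₀ : ∀ {n} → NonZero n → Fin n
      i₀ {suc n} _ = Fin.zero
      inhabited : Satisfiable (support A xs)
      inhabited = xs (i₀ (arity>0 σ R)) , _ , A.refl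
      go : ∀ g → IsGuarded g A (support A xs)
      go atom   = inj₂ (R , xs , Rxs , (λ x → x) , (λ x → x))
      go loose  = inhabited , λ { {_ , x∈} {_ , y∈} _ _ x≉y →
        x≉y , R , (λ i → xs i , i , A.refl) , Rxs , x∈ , y∈ }
      go clique = inhabited , λ x∈ y∈ x≉y → x≉y , R , xs , Rxs , x∈ , y∈

    -- The homomorphism b ↦ [p , b] on λ(p)
    focusAt : (p : Play g A) → Hom (A ↾ member (last p)) 𝔾
    focusAt p = record
      { func = record
        { to   = λ { (x , x∈) → ⟨ p , x ⟩[ x∈ ] }
        ; cong = λ x≈y → ≋⇒∼ x≈y (Setoid.refl (playSetoid g A) {p}) }
      ; preserves = λ R {xs} Rxs → p , map proj₁ xs , (λ i → proj₂ (xs i)) , Rxs , λ i →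
          ≋⇒∼ A.refl (Setoid.refl (playSetoid g A) {p}) }

    focusAt-adjacent : ∀ p x y → Adjacent A (proj₁ x) (proj₁ y) →
                       CoOccur 𝔾 (Hom.⟨_⟩ (focusAt p) x) (Hom.⟨_⟩ (focusAt p) y)
    focusAt-adjacent p x y (_ , R , xs , Rxs , x∈ , y∈) =
      R , Xs , (p ⁺∷ʳ V , xs , xs∈ , Rxs , λ i → Setoid.refl (domain 𝔾) {Xs i})
        , (proj₁ x∈ , extend x x∈) , (proj₁ y∈ , extend y y∈)
      where
      V : GuardedSet g A
      V = support-guarded R Rxs
      xs∈ : ∀ i → xs i ∈ᴸ (p ⁺∷ʳ V)
      xs∈ i rewrite last-⁺∷ʳ p V = i , A.refl
      Xs : Vector (FocussedPlay g A) _
      Xs i = ⟨ p ⁺∷ʳ V , xs i ⟩[ xs∈ i ]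
      extend : ∀ z (z∈ : support A xs (proj₁ z)) → Hom.⟨_⟩ (focusAt p) z ∼ Xs (proj₁ z∈)
      extend (z , z∈p) (i , z≈) =
        ⊑⇒∼ z≈ (PrefixOrder.⊑-⁺∷ʳ (guardedSetoid g A) p V) λ u p⊑u u⊑ →
          stay u (PrefixOrder.⊑-⁺∷ʳ⁻ (guardedSetoid g A) {u} p V p⊑u u⊑)
        where
        z∈V : z ∈ᴸ (p ⁺∷ʳ V)
        z∈V rewrite last-⁺∷ʳ p V = i , z≈
        stay : ∀ u → p ≋ u ⊎ (p ⁺∷ʳ V) ≋ u → z ∈ᴸ u
        stay u (inj₁ eq) = ∈λ-resp p u eq z∈p
        stay u (inj₂ eq) = ∈λ-resp (p ⁺∷ʳ V) u eq z∈V

    -- { [p , b] ∣ b ∈ λ(p) }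
    T : Play g A → GuardedSet g 𝔾
    T p = record
      { member  = image {ℓ′ = s ⊔ lsuc ℓ} {A = A} {B = 𝔾} (focusAt p)
      ; resp    = image-resp {ℓ′ = s ⊔ lsuc ℓ} {A = A} {B = 𝔾} (focusAt p)
      ; guarded = image-guarded {ℓ′ = s ⊔ lsuc ℓ} {A = A} {B = 𝔾} (focusAt p)
                    (focusAt-adjacent p) g (guarded (last p)) }

    T-cong : ∀ {p q} → p ≋ q → ∀ {X} → member (T p) X → member (T q) X
    T-cong {p} {q} p≋q ((x , x∈) , X∼) =
      (x , ∈λ-resp p q p≋q x∈) , ∼-trans X∼ (≋⇒∼ A.refl p≋q)

    δ-play : Play g A → Play g 𝔾
    δ-play p = List⁺.map T (prefixes p)

    last-δ : ∀ p → last (δ-play p) ≡ T p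
    last-δ p = ≡.trans (last-map T (prefixes p)) (≡.cong T (last-prefixes p))

    δ-to : FocussedPlay g A → FocussedPlay g 𝔾
    δ-to P = ⟨ δ-play (play P) , P ⟩[ ≡.subst (λ V → member V P) (≡.sym (last-δ (play P)))
      ((focus P , focus∈ P) , Setoid.refl (domain 𝔾) {P}) ]

  module _ (A : Structure σ ℓ) where
    private
      module A = Structure A
      module GA = Structure (𝔾 A)
      module S = PrefixOrder (guardedSetoid g A)

    prefixesˡ-mono : ∀ {xs ys} → xs S.⊑ˡ ys → Prefix S._≋_ (prefixesˡ xs) (prefixesˡ ys)
    prefixesˡ-mono []       = []
    prefixesˡ-mono (e ∷ es) =
      (e ∷ []) ∷ Prefix.map⁺ _ _ (Prefix-map (e ∷_) (prefixesˡ-mono es))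

    δ-mono : ∀ {p q} → p S.⊑ q → _⊑_ (𝔾 A) (δ-play A p) (δ-play A q)
    δ-mono {p} {q} p⊑q = Prefix.map⁺ (T A) (T A)
      (Prefix-map (λ {p} {q} p≋q → (λ {X} → T-cong A {p} {q} p≋q {X})
        , (λ {X} → T-cong A {q} {p} (Setoid.sym (playSetoid g A) {p} {q} p≋q) {X}))
        (prefixesˡ-mono p⊑q))

    δ-cong : ∀ {P Q} → P GA.≈ Q → _∼_ (𝔾 A) (δ-to A P) (δ-to A Q)
    δ-cong {P} {Q} e = common⇒∼ (𝔾 A) {δ-to A P} {δ-to A Q} (δ-play A root) e
      (δ-mono {root} {play P} root⊑ˡ) (δ-mono {root} {play Q} root⊑ʳ)
      (stay P root⊑ˡ GA.refl stayˡ)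
      (stay Q root⊑ʳ e λ u r⊑u u⊑q → resp (last u) (_∼_.focus≈ e) (stayʳ u r⊑u u⊑q))
      where
      open Common (∼⇒common A e)
      stay : ∀ Z → root S.⊑ play Z → P GA.≈ Z →
             (∀ u → root S.⊑ u → u S.⊑ play Z → _∈λ_ g A (focus Z) u) →
             ∀ w → _⊑_ (𝔾 A) (δ-play A root) w → _⊑_ (𝔾 A) w (δ-play A (play Z)) →
             _∈λ_ g (𝔾 A) P w
      stay Z r⊑z P∼Z on w Fr⊑w w⊑Fz = ∈λ-resp (δ-play A u) w Fu≋w
        (≡.subst (λ V → member V P) (≡.sym (last-δ A u))
          ((focus Z , on u r⊑u u⊑z) , GA.trans P∼Z (GA.sym (⊑⇒∼ A A.refl u⊑z
            λ v u⊑v v⊑z → on v (S.⊑-trans r⊑u u⊑v) v⊑z))))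
        where
        lifted = lift-interval (guardedSetoid g A) (guardedSetoid g (𝔾 A)) (δ-play A)
          (λ n p → ≡.trans (≡.cong (List⁺.map (T A)) (prefixes-take⁺ n p))
                           (take⁺-map (T A) n (prefixes p)))
          (λ p → ≡.trans (size-map (T A) (prefixes p)) (size-prefixes p))
          root (play Z) w r⊑z Fr⊑w w⊑Fz
        u    = proj₁ lifted
        r⊑u  = proj₁ (proj₂ lifted)
        u⊑z  = proj₁ (proj₂ (proj₂ lifted))
        Fu≋w = proj₂ (proj₂ (proj₂ lifted))

    δ : Hom (𝔾 A) (𝔾 (𝔾 A))
    δ = record
      { func      = record { to = δ-to A ; cong = δ-cong }
      ; preserves = λ { R {Xs} (p , xs , xs∈ , Rxs , Xs∼) →
          let Ys = λ i → ⟨ p , xs i ⟩[ xs∈ i ] in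
          δ-play A p , Ys , (λ i → focus∈ (δ-to A (Ys i)))
          , (p , xs , xs∈ , Rxs , λ i → GA.refl {Ys i}) , λ i → δ-cong (Xs∼ i) } }

  -- The action of 𝔾 on homomorphisms.  The level of B is written as ℓ ⊔ ℓ′
  -- because the image of a guarded set quantifies over the domain of A.
  module _ {A : Structure σ ℓ} {B : Structure σ (ℓ ⊔ ℓ′)} (f : Hom A B) where
    private
      module A = Structure A
      module B = Structure B
      module GA = Structure (𝔾 A)
      module S = PrefixOrder (guardedSetoid g A)
      open Hom f using (⟨_⟩; cong; preserves)

    restrict : (U : Pred ∣ A ∣ ℓ) → Hom (A ↾ U) B
    restrict U = record
      { func      = record { to = λ x → ⟨ proj₁ x ⟩ ; cong = cong }
      ; preserves = λ R Rxs → preserves R Rxs }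

    imageᴳ : GuardedSet g A → GuardedSet g B
    imageᴳ U = record
      { member  = image {ℓ′ = ℓ′} {A = A} {B = B} (restrict (member U))
      ; resp    = image-resp {ℓ′ = ℓ′} {A = A} {B = B} (restrict (member U))
      ; guarded = image-guarded {ℓ′ = ℓ′} {A = A} {B = B} (restrict (member U))
          (λ { x y (_ , R , xs , Rxs , (i , x≈) , (j , y≈)) →
               R , map ⟨_⟩ xs , preserves R Rxs , (i , cong x≈) , (j , cong y≈) })
          g (guarded U) }

    map-play : Play g A → Play g B
    map-play = List⁺.map imageᴳ

    map-∈λ : ∀ u {x} → _∈λ_ g A x u → _∈λ_ g B ⟨ x ⟩ (map-play u)
    map-∈λ u {x} x∈ = ≡.subst (λ V → member V ⟨ x ⟩) (≡.sym (last-map imageᴳ u))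
      ((x , x∈) , B.refl)

    map-to : FocussedPlay g A → FocussedPlay g B
    map-to P = ⟨ map-play (play P) , ⟨ focus P ⟩ ⟩[ map-∈λ (play P) (focus∈ P) ]

    map-mono : ∀ {p q} → p S.⊑ q → _⊑_ B (map-play p) (map-play q)
    map-mono p⊑q = Prefix.map⁺ imageᴳ imageᴳ (Prefix-map
      (λ { (U⊆V , V⊆U) → (λ { ((x , x∈) , y≈) → (x , U⊆V x∈) , y≈ })
                       , (λ { ((x , x∈) , y≈) → (x , V⊆U x∈) , y≈ }) }) p⊑q)

    map-cong : ∀ {P Q} → P GA.≈ Q → _∼_ B (map-to P) (map-to Q)
    map-cong {P} {Q} e = common⇒∼ B {map-to P} {map-to Q} (map-play root)
      (cong (_∼_.focus≈ e)) (map-mono {root} {play P} root⊑ˡ) (map-mono {root} {play Q} root⊑ʳ)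
      (stay (play P) root⊑ˡ stayˡ) (stay (play Q) root⊑ʳ stayʳ)
      where
      open Common (∼⇒common A e)
      stay : ∀ z → root S.⊑ z → (∀ u → root S.⊑ u → u S.⊑ z → _∈λ_ g A (focus P) u) →
             ∀ w → _⊑_ B (map-play root) w → _⊑_ B w (map-play z) →
             _∈λ_ g B ⟨ focus P ⟩ w
      stay z r⊑z on w Fr⊑w w⊑Fz =
        let u , r⊑u , u⊑z , Fu≋w = lift-interval (guardedSetoid g A) (guardedSetoid g B)
              map-play (take⁺-map imageᴳ) (size-map imageᴳ) root z w r⊑z Fr⊑w w⊑Fz
        in ∈λ-resp (map-play u) w Fu≋w (map-∈λ u (on u r⊑u u⊑z))

    𝔾-map : Hom (𝔾 A) (𝔾 B)
    𝔾-map = record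
      { func      = record { to = map-to ; cong = map-cong }
      ; preserves = λ { R {Xs} (p , xs , xs∈ , Rxs , Xs∼) →
          map-play p , map ⟨_⟩ xs , (λ i → map-∈λ p (xs∈ i)) , preserves R Rxs
          , λ i → Setoid.trans (domain (𝔾 B)) {map-to (Xs i)}
              {map-to ⟨ p , xs i ⟩[ xs∈ i ]} (map-cong (Xs∼ i))
              (≋⇒∼ B B.refl (Setoid.refl (playSetoid g B) {map-play p})) } }

  module _ (A : Structure σ ℓ) where
    private
      module A = Structure A
      _∈ᴸ_ = _∈λ_ g A

    record Coalgebra : Set (lsuc (s ⊔ lsuc ℓ)) where
      field
        α : Hom A (𝔾 A)
      open Hom using (⟨_⟩)
      field
        counit  : ∀ x → ⟨ ε A ⟩ (⟨ α ⟩ x) A.≈ x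
        coassoc : ∀ x → _∼_ (𝔾 A) (⟨ δ A ⟩ (⟨ α ⟩ x))
                    (⟨ 𝔾-map {ℓ′ = s ⊔ lsuc ℓ} {B = 𝔾 A} α ⟩ (⟨ α ⟩ x))

    record Decomposition : Set (s ⊔ lsuc ℓ) where
      field
        τ : Func (domain A) (playSetoid g A)
      open Func τ public renaming (to to τ⟨_⟩)

      Pτ : Pred (Play g A) (s ⊔ lsuc ℓ)
      Pτ p = ∃ λ x → _≋_ A p τ⟨ x ⟩

      ↓Pτ : Pred (Play g A) (s ⊔ lsuc ℓ)
      ↓Pτ q = ∃ λ p → Pτ p × _⊑_ A q p

      field
        reflexive       : ∀ x → x ∈ᴸ τ⟨ x ⟩
        edgeCovering    : ∀ x y → Adjacent A x y → ∃ λ p → Pτ p × x ∈ᴸ p × y ∈ᴸ p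
        minimal         : ∀ x q (x∈ : x ∈ᴸ q) →
                          _∼_ A ⟨ τ⟨ x ⟩ , x ⟩[ reflexive x ] ⟨ q , x ⟩[ x∈ ] →
                          _⊑_ A τ⟨ x ⟩ q
        vertexConnected : ∀ q → ↓Pτ q → ∀ x (x∈ : x ∈ᴸ q) →
                          _∼_ A ⟨ τ⟨ x ⟩ , x ⟩[ reflexive x ] ⟨ q , x ⟩[ x∈ ]

    coalgebraSetoid : Setoid (lsuc (s ⊔ lsuc ℓ)) (s ⊔ lsuc ℓ)
    coalgebraSetoid = record
      { Carrier = Coalgebra
      ; _≈_ = λ C D → ∀ x → _∼_ A (Hom.⟨_⟩ (Coalgebra.α C) x) (Hom.⟨_⟩ (Coalgebra.α D) x)
      ; isEquivalence = record
        { refl  = λ x → Setoid.refl (domain (𝔾 A))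
        ; sym   = λ e x → ∼-sym A (e x)
        ; trans = λ e f x → ∼-trans A (e x) (f x) } }

    decompositionSetoid : Setoid (s ⊔ lsuc ℓ) (s ⊔ lsuc ℓ)
    decompositionSetoid = record
      { Carrier = Decomposition
      ; _≈_ = λ C D → ∀ x → _≋_ A (Decomposition.τ⟨_⟩ C x) (Decomposition.τ⟨_⟩ D x)
      ; isEquivalence = record
        { refl  = λ {C} x → S.refl {Decomposition.τ⟨_⟩ C x}
        ; sym   = λ {C} {D} e x →
            S.sym {Decomposition.τ⟨_⟩ C x} {Decomposition.τ⟨_⟩ D x} (e x)
        ; trans = λ {C} {D} {E} e f x →
            S.trans {Decomposition.τ⟨_⟩ C x} {Decomposition.τ⟨_⟩ D x}
              {Decomposition.τ⟨_⟩ E x} (e x) (f x) } }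
      where module S = Setoid (playSetoid g A)

{-# OPTIONS --safe #-}
-- A class [p , x] has a least representative: the shortest prefix of p from
-- which x stays in every later set.  For a coalgebra α, let τ(x) be the least
-- representative p = [U₁, …, Uₙ] of α(x).  By leastness α(x) lies in Tₙ but in
-- no earlier Tⱼ, so coassociativity forces the whole of [T₁, …, Tₙ] to agree
-- with [α(U₁), …, α(Uₙ)], and Tⱼ = α(Uⱼ) is vertex connectedness.  Conversely,
-- given τ, put α(x) = [τ(x) , x]: the plays assigned to the entries of a tuple
-- form a chain, and its greatest element witnesses that the tuple is related
-- in 𝔾A.
module Submission where

open import Defs hiding (_⊑_; _⊑ˡ_; _≋_)
open import Axiom.ExcludedMiddle using (ExcludedMiddle)
open import Data.Fin.Base using (Fin; zero; suc)
open import Data.List.Base as List using ([]; _∷_; length)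
import Data.List.Properties as List
open import Data.List.NonEmpty as List⁺ using (List⁺; _∷_; [_]; toList; _∷⁺_; last)
open import Data.List.Relation.Binary.Pointwise using (Pointwise; []; _∷_)
open import Data.List.Relation.Binary.Prefix.Heterogeneous using ([]; _∷_)
import Data.List.Relation.Binary.Prefix.Heterogeneous.Properties as Prefix
open import Data.Nat.Base using (suc; NonZero)
open import Data.Nat.Properties using (suc-injective)
open import Data.Product.Base using (∃; _×_; _,_; proj₁; proj₂; swap)
open import Data.Sum.Base using (_⊎_; inj₁; inj₂)
open import Function.Bundles using (Func; Inverse)
open import Level using (Level; _⊔_) renaming (suc to lsuc)
open import Relation.Binary.Bundles using (Setoid)
open import Relation.Binary.Core using (Rel)
open import Relation.Binary.Definitions using (Reflexive; Total; Transitive)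
open import Relation.Binary.PropositionalEquality as ≡ using (_≡_)
open import Relation.Nullary.Decidable.Core using (yes; no)
open import Relation.Nullary.Negation.Core using (contradiction)
open import Relation.Unary using (Pred; Decidable; _≐_)

open FocussedPlay
open GuardedSet

private
  variable
    b c s ℓ ℓ′ : Level

-- Prefixes of lists and finite chains.

module _ (S : Setoid c ℓ) where
  open Setoid S using (Carrier; refl; sym; trans)
  open PrefixOrder S

  ⊑-antisym : ∀ {p q} → p ⊑ q → q ⊑ p → p ≋ q
  ⊑-antisym = Prefix.antisym (λ e _ → e)

  ⊑-same-size : ∀ {p q r} → p ⊑ r → q ⊑ r → size p ≡ size q → p ≋ q
  ⊑-same-size (e ∷ es) (f ∷ fs) eq = trans e (sym f) ∷ go es fs eq
    where
    go : ∀ {xs ys zs} → xs ⊑ˡ zs → ys ⊑ˡ zs → length xs ≡ length ys →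
         Pointwise (Setoid._≈_ S) xs ys
    go []       []       eq = []
    go (e ∷ es) (f ∷ fs) eq = trans e (sym f) ∷ go es fs (suc-injective eq)

  -- The shortest prefix `[ x ]` is tested first; if it fails, the search moves to the tail with `G`
  -- precomposed with `x ∷⁺_`, so `go` quantifies over `G` afresh.
  least-prefix : {G : Pred (List⁺ Carrier) ℓ′} → (∀ {p q} → p ≋ q → G p → G q) →
                 Decidable G → ∀ p → G p →
                 ∃ λ q → q ⊑ p × G q × (∀ r → r ⊑ p → G r → q ⊑ r)
  least-prefix resp G? (x ∷ xs) = go resp G? x xs
    where
    go : {G : Pred (List⁺ Carrier) ℓ′} → (∀ {p q} → p ≋ q → G p → G q) →
         Decidable G → ∀ x xs → G (x ∷ xs) →
         ∃ λ q → q ⊑ (x ∷ xs) × G q × (∀ r → r ⊑ (x ∷ xs) → G r → q ⊑ r)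
    go resp G? x xs Gp with G? [ x ]
    go resp G? x xs Gp | yes Gx =
      [ x ] , refl ∷ [] , Gx , λ { _ (e ∷ _) _ → sym e ∷ [] }
    go resp G? x [] Gp | no ¬Gx = contradiction Gp ¬Gx
    go resp G? x (y ∷ ys) Gp | no ¬Gx =
      let q , q⊑ , Gq , least = go (λ p≋q → resp (refl ∷ p≋q)) (λ q → G? (x ∷⁺ q)) y ys Gp
      in x ∷⁺ q , refl ∷ q⊑ , Gq ,
         λ { (z ∷ [])     (e ∷ _)  Gz → contradiction (resp (e ∷ []) Gz) ¬Gx
           ; (z ∷ w ∷ ws) (e ∷ es) Gr → sym e ∷ least (w ∷ ws) es
               (resp (e ∷ Setoid.refl List⁺-setoid {w ∷ ws}) Gr) }

module _ (S : Setoid c ℓ) (T : Setoid b ℓ′) where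
  private
    module S = PrefixOrder S
    module T = PrefixOrder T
    open Setoid S using () renaming (Carrier to C)
    open Setoid T using (_≈_) renaming (Carrier to D)

  -- Used with `f = T` and `h` the image under α, to compare the two plays in the coassociativity
  -- law. Each recursive call of `go` absorbs the head into `f`.
  map-prefixes : (f : List⁺ C → D) (h : C → D) → ∀ p →
                 (∀ q → q S.⊑ p → f q ≈ h (last q)) →
                 List⁺.map f (prefixes p) T.≋ List⁺.map h p
  map-prefixes f h (x ∷ xs) = go f (x ∷ xs)
    where
    go : (f : List⁺ C → D) → ∀ xs → (∀ q → toList q S.⊑ˡ xs → f q ≈ h (last q)) →
         Pointwise _≈_ (List.map f (prefixesˡ xs)) (List.map h xs)
    go f []       eq = []
    go f (x ∷ xs) eq = eq [ x ] (Setoid.refl S ∷ [])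
      ∷ ≡.subst (λ ys → Pointwise _≈_ ys (List.map h xs)) (List.map-∘ (prefixesˡ xs))
          (go (λ q → f (x ∷⁺ q)) xs λ q@(y ∷ ys) q⊑ →
            ≡.subst (λ z → f (x ∷⁺ q) ≈ h z) (last-∷ x y ys)
              (eq (x ∷⁺ q) (Setoid.refl S ∷ q⊑)))

chain-max : ∀ {n} → NonZero n → {_≤_ : Rel (Fin n) ℓ} → Reflexive _≤_ → Transitive _≤_ →
            Total _≤_ → ∃ λ m → ∀ i → i ≤ m
chain-max {n = 1}           _ refl trans total = zero , λ { zero → refl }
chain-max {n = suc (suc _)} _ {_≤_} refl trans total
  with m , ≤m ← chain-max _ {λ i j → suc i ≤ suc j} refl trans (λ i j → total (suc i) (suc j))
  with total zero (suc m)
... | inj₁ 0≤m = suc m , λ { zero → 0≤m ; (suc i) → ≤m i }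
... | inj₂ m≤0 = zero  , λ { zero → refl ; (suc i) → trans (≤m i) m≤0 }

-- Least representatives of classes of focussed plays.

module _ (em : ∀ {ℓ} → ExcludedMiddle ℓ) {σ : Signature s} (g : Guard) (A : Structure σ ℓ) where
  private
    module A = Structure A
    module GA = Structure (𝔾 em g A)
    module GGA = Structure (𝔾 em g (𝔾 em g A))
    module S = PrefixOrder (guardedSetoid g A)
    module P = Setoid (playSetoid g A)
    module Sᴳ = PrefixOrder (guardedSetoid g (𝔾 em g A))
    _∈ᴸ_ = _∈λ_ g A
    open S using (_⊑_; _≋_)

    infix 4 _≈ᴳ_
    _≈ᴳ_ = _∼_ em g A

  -- For `q ⊑ p` this expresses [q , x] = [p , x]. The lower end comes last, as it is the one to be
  -- minimised.
  Stays : ∣ A ∣ → Play g A → Play g A → Set _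
  Stays x p q = ∀ u → q ⊑ u → u ⊑ p → x ∈ᴸ u

  ∼-stays : ∀ {P Q} → P ≈ᴳ Q → play P ⊑ play Q → Stays (focus P) (play Q) (play P)
  ∼-stays P∼Q p⊑q u p⊑u = stayʳ u (S.⊑-trans root⊑ˡ p⊑u)
    where open Common (∼⇒common em g A P∼Q)

  least-play : ∀ P → ∃ λ q → q ⊑ play P × Stays (focus P) (play P) q ×
               (∀ r → r ⊑ play P → Stays (focus P) (play P) r → q ⊑ r)
  least-play P = least-prefix (guardedSetoid g A)
    (λ q≋r on u r⊑u → on u (S.⊑-trans (Prefix.fromPointwise q≋r) r⊑u))
    (λ _ → em) (play P)
    λ u p⊑u u⊑p → ∈λ-resp (play P) u (⊑-antisym (guardedSetoid g A) {play P} {u} p⊑u u⊑p) (focus∈ P)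

  rep : FocussedPlay g A → Play g A
  rep P = proj₁ (least-play P)

  module _ (P : FocussedPlay g A) where
    rep-⊑ : rep P ⊑ play P
    rep-⊑ = proj₁ (proj₂ (least-play P))

    rep-stays : Stays (focus P) (play P) (rep P)
    rep-stays = proj₁ (proj₂ (proj₂ (least-play P)))

    rep-∈ : focus P ∈ᴸ rep P
    rep-∈ = rep-stays (rep P) S.⊑-refl rep-⊑

  -- The common root is a prefix of `play P` from which the focus stays, so it extends `rep P`.
  -- Hence `rep P` is least in the whole class, not only among prefixes of `play P`.
  rep-least : ∀ {P Q} → P ≈ᴳ Q → rep P ⊑ play Q
  rep-least {P} P∼Q = S.⊑-trans (proj₂ (proj₂ (proj₂ (least-play P))) root root⊑ˡ stayˡ) root⊑ʳ
    where open Common (∼⇒common em g A P∼Q)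

  -- The focus may change to an equal `x`, because the counit law gives the focus of α(x) only up to
  -- `≈`.
  rep-∼ : ∀ P {x} → focus P A.≈ x → (x∈ : x ∈ᴸ rep P) → ⟨ rep P , x ⟩[ x∈ ] ≈ᴳ P
  rep-∼ P P≈x x∈ = ⊑⇒∼ em g A (A.sym P≈x) (rep-⊑ P)
    λ u r⊑u u⊑p → resp (last u) P≈x (rep-stays P u r⊑u u⊑p)

  rep-cong : ∀ {P Q} → P ≈ᴳ Q → rep P ≋ rep Q
  rep-cong {P} {Q} P∼Q = ⊑-antisym (guardedSetoid g A) {rep P} {rep Q}
    (rep-least {P} {⟨ rep Q , focus Q ⟩[ rep-∈ Q ]}
      (∼-trans em g A P∼Q (∼-sym em g A (rep-∼ Q A.refl (rep-∈ Q)))))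
    (rep-least {Q} {⟨ rep P , focus P ⟩[ rep-∈ P ]}
      (∼-trans em g A (∼-sym em g A P∼Q) (∼-sym em g A (rep-∼ P A.refl (rep-∈ P)))))

  δ-play-take : ∀ n p → δ-play em g A (take⁺ n p) ≡ take⁺ n (δ-play em g A p)
  δ-play-take n p = ≡.trans (≡.cong (List⁺.map (T em g A)) (prefixes-take⁺ n p))
                            (take⁺-map (T em g A) n (prefixes p))

  δ-play-size : ∀ p → size (δ-play em g A p) ≡ size p
  δ-play-size p = ≡.trans (size-map (T em g A) (prefixes p)) (size-prefixes p)

  -- From coalgebras to decompositions.

  module _ (C : Coalgebra em g A) where
    open Coalgebra C
    private
      α⟨_⟩ = Hom.⟨_⟩ α

    leastPlay : ∣ A ∣ → Play g A
    leastPlay x = rep α⟨ x ⟩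

    leastPlay-∈ : ∀ x → x ∈ᴸ leastPlay x
    leastPlay-∈ x = resp (last (leastPlay x)) (counit x) (rep-∈ α⟨ x ⟩)

    leastPlay-∼ : ∀ x → ⟨ leastPlay x , x ⟩[ leastPlay-∈ x ] ≈ᴳ α⟨ x ⟩
    leastPlay-∼ x = rep-∼ α⟨ x ⟩ (counit x) (leastPlay-∈ x)

    -- Such an `m` is `δ-play u` for a prefix `u` of the least play. Its last set is `T u`, so `u`
    -- carries the class of α(x), and leastness makes `u` the whole play.
    δ-play-least : ∀ x m → m Sᴳ.⊑ δ-play em g A (leastPlay x) →
                   _∈λ_ g (𝔾 em g A) ⟨ leastPlay x , x ⟩[ leastPlay-∈ x ] m →
                   δ-play em g A (leastPlay x) Sᴳ.⊑ m
    δ-play-least x m@(_ ∷ _) m⊑δp@(e ∷ _) Q∈m =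
      Sᴳ.⊑-trans (δ-mono em g A {p} {u} p⊑u) (Prefix.fromPointwise δu≋m)
      where
      p = leastPlay x
      Q = ⟨ p , x ⟩[ leastPlay-∈ x ]
      lifted = lift-interval (guardedSetoid g A) (guardedSetoid g (𝔾 em g A))
        (δ-play em g A) δ-play-take δ-play-size
        -- The one-set prefix serves as lower end: every non-empty prefix of `δ-play p` extends its
        -- image.
        [ List⁺.head p ] p m (Setoid.refl (guardedSetoid g A) {List⁺.head p} ∷ [])
        (swap e ∷ []) m⊑δp
      u = proj₁ lifted
      δu≋m : δ-play em g A u Sᴳ.≋ m
      δu≋m = proj₂ (proj₂ (proj₂ lifted))
      Q∈Tu : member (T em g A u) Q
      Q∈Tu = ≡.subst (λ V → member V Q) (last-δ em g A u)
        (∈λ-resp m (δ-play em g A u)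
          (Setoid.sym (playSetoid g (𝔾 em g A)) {δ-play em g A u} {m} δu≋m) Q∈m)
      p⊑u : p ⊑ u
      p⊑u = rep-least {α⟨ x ⟩} (∼-trans em g A (∼-sym em g A (leastPlay-∼ x)) (proj₂ Q∈Tu))

    private
      α-play : Play g A → Play g (𝔾 em g A)
      α-play = map-play em g {ℓ′ = s ⊔ lsuc ℓ} {B = 𝔾 em g A} α

      α-to : FocussedPlay g A → FocussedPlay g (𝔾 em g A)
      α-to = map-to em g {ℓ′ = s ⊔ lsuc ℓ} {B = 𝔾 em g A} α

    -- Coassociativity gives the two plays a common root whose last set contains `Q`; by
    -- `δ-play-least` that root already extends the first play.
    δ-play⊑α-play : ∀ x → δ-play em g A (leastPlay x) Sᴳ.⊑ α-play (leastPlay x)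
    δ-play⊑α-play x = Sᴳ.⊑-trans
      (δ-play-least x root root⊑ˡ (stayˡ root Sᴳ.⊑-refl root⊑ˡ)) root⊑ʳ
      where
      Q = ⟨ leastPlay x , x ⟩[ leastPlay-∈ x ]
      δQ∼αQ : _∼_ em g (𝔾 em g A) (δ-to em g A Q) (α-to Q)
      δQ∼αQ = GGA.trans {δ-to em g A Q} {δ-to em g A α⟨ x ⟩} {α-to Q}
        (δ-cong em g A {Q} {α⟨ x ⟩} (leastPlay-∼ x))
        (GGA.trans {δ-to em g A α⟨ x ⟩} {α-to α⟨ x ⟩} {α-to Q} (coassoc x)
          (map-cong em g {ℓ′ = s ⊔ lsuc ℓ} {A = A} {B = 𝔾 em g A} α {α⟨ x ⟩} {Q}
            (GA.sym {Q} {α⟨ x ⟩} (leastPlay-∼ x))))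
      open Common (∼⇒common em g (𝔾 em g A) {δ-to em g A Q} {α-to Q} δQ∼αQ)

    -- `δ-play q` and `α-play q` are prefixes of one play and have equal size, so their last sets
    -- agree and α(y) lies in `T q`.
    leastPlay-connected : ∀ x q → q ⊑ leastPlay x → ∀ y (y∈ : y ∈ᴸ q) →
      ⟨ leastPlay y , y ⟩[ leastPlay-∈ y ] ≈ᴳ ⟨ q , y ⟩[ y∈ ]
    leastPlay-connected x q q⊑p y y∈ =
      ∼-trans em g A (leastPlay-∼ y) (∼-trans em g A αy∼
        -- Membership in `T q` yields [q , z] for some z; the counit law identifies z with `y`.
        (≋⇒∼ em g A (A.trans (A.sym (_∼_.focus≈ αy∼)) (counit y)) (P.refl {q})))
      where
      δq≋αq : δ-play em g A q Sᴳ.≋ α-play q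
      δq≋αq = ⊑-same-size (guardedSetoid g (𝔾 em g A)) {δ-play em g A q} {α-play q} {α-play (leastPlay x)}
        (Sᴳ.⊑-trans (δ-mono em g A {q} {leastPlay x} q⊑p) (δ-play⊑α-play x))
        (map-mono em g {ℓ′ = s ⊔ lsuc ℓ} {B = 𝔾 em g A} α {q} {leastPlay x} q⊑p)
        (≡.trans (δ-play-size q) (≡.sym (size-map (imageᴳ em g {ℓ′ = s ⊔ lsuc ℓ} {B = 𝔾 em g A} α) q)))
      αy∈Tq : member (T em g A q) α⟨ y ⟩
      αy∈Tq = ≡.subst (λ V → member V α⟨ y ⟩) (last-δ em g A q)
        (∈λ-resp (α-play q) (δ-play em g A q)
          (Setoid.sym (playSetoid g (𝔾 em g A)) {δ-play em g A q} {α-play q} δq≋αq)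
          (map-∈λ em g {ℓ′ = s ⊔ lsuc ℓ} {B = 𝔾 em g A} α q y∈))
      αy∼ = proj₂ αy∈Tq

    -- As α preserves `R`, one play `p` represents both classes. The two least plays are prefixes of
    -- `p`, hence comparable, and the element with the shorter one stays in the longer.
    leastPlay-covers : ∀ x y → Adjacent A x y →
                       ∃ λ z → x ∈ᴸ leastPlay z × y ∈ᴸ leastPlay z
    leastPlay-covers x y (_ , R , xs , Rxs , (i , x≈) , (j , y≈)) =
      go (S.⊑-total (below x i x≈) (below y j y≈))
      where
      Rα = Hom.preserves α R Rxs
      p  = proj₁ Rα
      on : ∀ x i → x A.≈ xs i → α⟨ x ⟩ ≈ᴳ ⟨ p , _ ⟩[ proj₁ (proj₂ (proj₂ Rα)) i ]
      on x i x≈ = ∼-trans em g A (Hom.cong α x≈) (proj₂ (proj₂ (proj₂ (proj₂ Rα))) i)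
      below : ∀ x i → x A.≈ xs i → leastPlay x ⊑ p
      below x i x≈ = rep-least (on x i x≈)
      stays : ∀ x i → x A.≈ xs i → Stays x p (leastPlay x)
      stays x i x≈ = ∼-stays {⟨ leastPlay x , x ⟩[ leastPlay-∈ x ]}
        (∼-trans em g A (leastPlay-∼ x) (on x i x≈)) (below x i x≈)
      go : leastPlay x ⊑ leastPlay y ⊎ leastPlay y ⊑ leastPlay x →
           ∃ λ z → x ∈ᴸ leastPlay z × y ∈ᴸ leastPlay z
      go (inj₁ x⊑y) = y , stays x i x≈ (leastPlay y) x⊑y (below y j y≈) , leastPlay-∈ y
      go (inj₂ y⊑x) = x , leastPlay-∈ x , stays y j y≈ (leastPlay x) y⊑x (below x i x≈)

    decomposition : Decomposition em g A
    decomposition = record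
      { τ = record { to = leastPlay ; cong = λ x≈y → rep-cong (Hom.cong α x≈y) }
      ; reflexive = leastPlay-∈
      ; edgeCovering = λ x y adj → let z , x∈ , y∈ = leastPlay-covers x y adj in
          leastPlay z , (z , P.refl {leastPlay z}) , x∈ , y∈
      ; minimal = λ x q x∈ e → rep-least (∼-trans em g A (∼-sym em g A (leastPlay-∼ x)) e)
      ; vertexConnected = λ { q (p , (x , p≋) , q⊑p) y y∈ →
          leastPlay-connected x q (S.⊑-trans q⊑p (Prefix.fromPointwise p≋)) y y∈ } }

  -- From decompositions to coalgebras.

  module _ (D : Decomposition em g A) where
    open Decomposition D

    focussed : ∣ A ∣ → FocussedPlay g A
    focussed x = ⟨ τ⟨ x ⟩ , x ⟩[ reflexive x ]

    focussed-cong : ∀ {x y} → x A.≈ y → focussed x ≈ᴳ focussed y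
    focussed-cong x≈y = ≋⇒∼ em g A x≈y (Func.cong τ x≈y)

    prefix-connected : ∀ x q → q ⊑ τ⟨ x ⟩ → ∀ y (y∈ : y ∈ᴸ q) → focussed y ≈ᴳ ⟨ q , y ⟩[ y∈ ]
    prefix-connected x q q⊑ = vertexConnected q (τ⟨ x ⟩ , (x , P.refl {τ⟨ x ⟩}) , q⊑)

    focussed-preserves : ∀ R {xs} → Structure.⟦_⟧ A R xs →
                         Structure.⟦_⟧ (𝔾 em g A) R (λ i → focussed (xs i))
    focussed-preserves R {xs} Rxs =
        τ⟨ xs m ⟩ , xs , xs∈ , Rxs , λ i → prefix-connected (xs m) τ⟨ xs m ⟩ S.⊑-refl (xs i) (xs∈ i)
      where
      Joint : ∀ i j → Play g A → Set _
      Joint i j p = (∃ λ x∈ → focussed (xs i) ≈ᴳ ⟨ p , xs i ⟩[ x∈ ])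
                  × (∃ λ x∈ → focussed (xs j) ≈ᴳ ⟨ p , xs j ⟩[ x∈ ])
      joint : ∀ i j → ∃ (Joint i j)
      joint i j with em {P = xs i A.≈ xs j}
      -- Equal entries are not adjacent, so edge covering is replaced by their own play.
      ... | yes x≈y = τ⟨ xs j ⟩
        , (resp (last τ⟨ xs j ⟩) (A.sym x≈y) (reflexive (xs j))
          , ≋⇒∼ em g A A.refl (Func.cong τ x≈y))
        , (reflexive (xs j) , GA.refl {focussed (xs j)})
      ... | no  x≉y =
        let p , p∈Pτ , x∈ , y∈ = edgeCovering (xs i) (xs j)
              (x≉y , R , xs , Rxs , (i , A.refl) , (j , A.refl))
        in p , (x∈ , vertexConnected p (p , p∈Pτ , S.⊑-refl) (xs i) x∈)
             , (y∈ , vertexConnected p (p , p∈Pτ , S.⊑-refl) (xs j) y∈)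
      comparable : ∀ i j → τ⟨ xs i ⟩ ⊑ τ⟨ xs j ⟩ ⊎ τ⟨ xs j ⟩ ⊑ τ⟨ xs i ⟩
      comparable i j =
        let p , (x∈ , x∼) , (y∈ , y∼) = joint i j
        in S.⊑-total (minimal (xs i) p x∈ x∼) (minimal (xs j) p y∈ y∼)
      greatest = chain-max (Signature.arity>0 σ R) S.⊑-refl S.⊑-trans comparable
      m = proj₁ greatest
      xs∈ : ∀ i → xs i ∈ᴸ τ⟨ xs m ⟩
      -- `τ⟨ xs m ⟩` lies between `τ⟨ xs i ⟩` and the joint play, and `xs i` stays throughout that
      -- interval.
      xs∈ i =
        let p , (x∈ , x∼) , (y∈ , y∼) = joint i m
        in ∼-stays x∼ (minimal (xs i) p x∈ x∼) τ⟨ xs m ⟩ (proj₂ greatest i)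
             (minimal (xs m) p y∈ y∼)

    α : Hom A (𝔾 em g A)
    α = record
      { func      = record { to = focussed ; cong = focussed-cong }
      ; preserves = focussed-preserves }

    -- Vertex connectedness gives [q , y] = α(y) for each y in the last set of `q`.
    T≐image : ∀ x q → q ⊑ τ⟨ x ⟩ →
              member (T em g A q) ≐ member (imageᴳ em g {ℓ′ = s ⊔ lsuc ℓ} {B = 𝔾 em g A} α (last q))
    T≐image x q q⊑ =
        (λ { ((y , y∈) , X∼) → (y , y∈) , ∼-trans em g A X∼ (∼-sym em g A (prefix-connected x q q⊑ y y∈)) })
      , (λ { ((y , y∈) , X∼) → (y , y∈) , ∼-trans em g A X∼ (prefix-connected x q q⊑ y y∈) })

    rep-focussed : ∀ x → rep (focussed x) ≋ τ⟨ x ⟩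
    rep-focussed x = ⊑-antisym (guardedSetoid g A) {rep (focussed x)} {τ⟨ x ⟩}
      (rep-⊑ (focussed x))
      (minimal x (rep (focussed x)) (rep-∈ (focussed x))
        (∼-sym em g A (rep-∼ (focussed x) A.refl (rep-∈ (focussed x)))))

    coalgebra : Coalgebra em g A
    coalgebra = record
      { α       = α
      ; counit  = λ x → A.refl
      ; coassoc = λ x → ≋⇒∼ em g (𝔾 em g A) {δ-to em g A (focussed x)}
          {map-to em g {ℓ′ = s ⊔ lsuc ℓ} {B = 𝔾 em g A} α (focussed x)} (GA.refl {focussed x})
          (map-prefixes (guardedSetoid g A) (guardedSetoid g (𝔾 em g A)) (T em g A)
            (imageᴳ em g {ℓ′ = s ⊔ lsuc ℓ} {B = 𝔾 em g A} α) τ⟨ x ⟩ (T≐image x)) }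

-- The two constructions are mutually inverse.

theorem4p11 : (em : ∀ {ℓ} → ExcludedMiddle ℓ) →
    ∀ {s ℓ : Level} {σ : Signature s} (g : Guard) (A : Structure σ ℓ) →
    Inverse (coalgebraSetoid em g A) (decompositionSetoid em g A)
theorem4p11 em g A = record
  { to        = decomposition em g A
  ; from      = coalgebra em g A
  ; to-cong   = λ C≈D x → rep-cong em g A (C≈D x)
  ; from-cong = λ D≈E x → ≋⇒∼ em g A (Structure.refl A) (D≈E x)
  ; inverse   =
      -- By minimality τ(x) is the least representative of its own class; in the other direction,
      -- the least representative still represents α(x).
      (λ {D} {C} C≈D x → Setoid.trans (playSetoid g A)
         {leastPlay em g A C x} {rep em g A (focussed em g A D x)} {Decomposition.τ⟨_⟩ D x}
         (rep-cong em g A (C≈D x)) (rep-focussed em g A D x))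
    , (λ {C} {D} D≈C x → ∼-trans em g A
         (≋⇒∼ em g A (Structure.refl A) (D≈C x)) (leastPlay-∼ em g A C x)) }
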